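{- Let $p$ be a positive integer and let $G$ be a $\{\text{butterfly},\text{hammer},C_4+K_p\}$-free graph such that no connected component of $G$ has clique number two. Then $\chi(G)\leq \omega(G)+\frac{p(p+1)}{2}$.
   Context: All graphs are simple, finite and undirected. $\omega(G)$ is the clique number and $\chi(G)$ the chromatic number of $G$. For a family $\mathcal{F}$ of graphs, $G$ is $\mathcal{F}$-free if it has no induced subgraph isomorphic to a member of $\mathcal{F}$. The butterfly is the graph on five vertices consisting of two triangles sharing exactly one vertex (with no other edges). The hammer is the graph on five vertices $a,b,c,d,e$ with edges $ab,bc,ac,cd,de$. $C_4$ is the cycle on four vertices and $K_p$ the complete graph on $p$ vertices. For vertex-disjoint graphs $G_1,G_2$, the join $G_1+G_2$ is obtained from their disjoint union by adding all edges between $V(G_1)$ and $V(G_2)$. -}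

module Defs where

open import Data.Fin.Base using (Fin; zero; suc; splitAt; finToFun; funToFin)
open import Data.Fin.Patterns using (0F; 1F; 2F; 3F; 4F)
open import Data.Fin.Properties using (any?; all?; finToFun-funToFin) renaming (_≟_ to _≟ᶠ_)
open import Data.Fin.Subset using (Subset; inside; outside; _∈_; ∣_∣) renaming (⊥ to ∅)
open import Data.Fin.Subset.Properties using (_∈?_; anySubset?; ∣p∣≤n; ∣⊥∣≡0; ∉⊥)
open import Data.List.Base using (List; []; _∷_)
open import Data.List.Membership.Propositional using () renaming (_∈_ to _∈ˡ_)
open import Data.List.Membership.DecPropositional using () renaming (_∈?_ to member?)
open import Data.List.Relation.Unary.All using (All)
open import Data.Nat.Base using (ℕ; zero; suc; _+_; _^_; _≤_; z≤n; s≤s)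
open import Data.Nat.Properties using (≤∧≢⇒<; m<1+n⇒m≤n) renaming (_≟_ to _≟ⁿ_)
open import Data.Product.Base using (Σ; ∃; ∃-syntax; _×_; _,_; proj₁)
open import Data.Product.Properties using (≡-dec)
open import Data.Sum.Base using (_⊎_; inj₁; inj₂; swap)
open import Data.Unit.Base using (⊤; tt)
open import Data.Vec.Base using ([]; _∷_)
open import Function.Base using (_∘_; id)
open import Function.Bundles using (_⇔_)
open import Function.Definitions using (Injective)
open import Level using (0ℓ)
open import Relation.Binary.Core using (Rel)
open import Relation.Binary.Construct.Closure.ReflexiveTransitive using (Star)
open import Relation.Binary.Definitions using (Decidable; Symmetric)
open import Relation.Binary.PropositionalEquality using (_≡_; _≢_; refl; sym; subst; subst₂; ≢-sym)
open import Relation.Nullary.Decidable using (Dec; yes; no; map′; ¬?; _×-dec_; _⊎-dec_; _→-dec_)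
open import Relation.Nullary.Negation using (¬_; contradiction)
open import Relation.Unary using (Pred) renaming (Decidable to Decidable₁)

record Graph (n : ℕ) : Set₁ where
  field
    Adj        : Rel (Fin n) 0ℓ
    adj?       : Decidable Adj
    adj-sym    : Symmetric Adj
    adj-irrefl : ∀ {u} → ¬ Adj u u

open Graph public

private
  variable
    m n : ℕ

-- Edges are listed in one orientation only; loops are discarded.
fromEdges : List (Fin n × Fin n) → Graph n
fromEdges es = record
  { Adj        = λ u v → u ≢ v × ((u , v) ∈ˡ es ⊎ (v , u) ∈ˡ es)
  ; adj?       = λ u v → ¬? (u ≟ᶠ v) ×-dec (mem? (u , v) ⊎-dec mem? (v , u))
  ; adj-sym    = λ (u≢v , e) → ≢-sym u≢v , swap e
  ; adj-irrefl = λ (u≢u , _) → u≢u refl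
  }
  where
  mem? : ∀ e → Dec (e ∈ˡ es)
  mem? e = member? (≡-dec _≟ᶠ_ _≟ᶠ_) e es

butterfly : Graph 5
butterfly = fromEdges
  ((0F , 1F) ∷ (1F , 2F) ∷ (0F , 2F) ∷ (2F , 3F) ∷ (3F , 4F) ∷ (2F , 4F) ∷ [])

hammer : Graph 5
hammer = fromEdges
  ((0F , 1F) ∷ (1F , 2F) ∷ (0F , 2F) ∷ (2F , 3F) ∷ (3F , 4F) ∷ [])

C₄ : Graph 4
C₄ = fromEdges ((0F , 1F) ∷ (1F , 2F) ∷ (2F , 3F) ∷ (3F , 0F) ∷ [])

K : ∀ p → Graph p
K p = record
  { Adj        = _≢_
  ; adj?       = λ u v → ¬? (u ≟ᶠ v)
  ; adj-sym    = ≢-sym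
  ; adj-irrefl = λ u≢u → u≢u refl
  }

module _ (G : Graph m) (H : Graph n) where

  JoinAdj : Rel (Fin m ⊎ Fin n) 0ℓ
  JoinAdj (inj₁ u) (inj₁ v) = Adj G u v
  JoinAdj (inj₁ u) (inj₂ v) = ⊤
  JoinAdj (inj₂ u) (inj₁ v) = ⊤
  JoinAdj (inj₂ u) (inj₂ v) = Adj H u v

  joinAdj? : Decidable JoinAdj
  joinAdj? (inj₁ u) (inj₁ v) = adj? G u v
  joinAdj? (inj₁ u) (inj₂ v) = yes tt
  joinAdj? (inj₂ u) (inj₁ v) = yes tt
  joinAdj? (inj₂ u) (inj₂ v) = adj? H u v

  joinAdj-sym : Symmetric JoinAdj
  joinAdj-sym {inj₁ u} {inj₁ v} = adj-sym G
  joinAdj-sym {inj₁ u} {inj₂ v} = id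
  joinAdj-sym {inj₂ u} {inj₁ v} = id
  joinAdj-sym {inj₂ u} {inj₂ v} = adj-sym H

  joinAdj-irrefl : ∀ s → ¬ JoinAdj s s
  joinAdj-irrefl (inj₁ u) = adj-irrefl G
  joinAdj-irrefl (inj₂ u) = adj-irrefl H

  -- The first m vertices of Fin (m + n) carry G, the last n carry H.
  join : Graph (m + n)
  join = record
    { Adj        = λ u v → JoinAdj (splitAt m u) (splitAt m v)
    ; adj?       = λ u v → joinAdj? (splitAt m u) (splitAt m v)
    ; adj-sym    = λ {u} {v} → joinAdj-sym {splitAt m u} {splitAt m v}
    ; adj-irrefl = λ {u} → joinAdj-irrefl (splitAt m u)
    }

-- H is isomorphic to an induced subgraph of G.
_⊴_ : Graph m → Graph n → Set
_⊴_ {m} {n} H G = ∃[ f ] Injective {A = Fin m} {B = Fin n} _≡_ _≡_ f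
                       × (∀ u v → Adj H u v ⇔ Adj G (f u) (f v))

_-free : List (Σ ℕ Graph) → Graph n → Set₁
(𝓕 -free) G = All (λ (_ , H) → ¬ (H ⊴ G)) 𝓕

-- The elements of S in increasing order.
element : (S : Subset n) → Fin ∣ S ∣ → Fin n
element (inside  ∷ S) zero    = zero
element (inside  ∷ S) (suc i) = suc (element S i)
element (outside ∷ S) i       = suc (element S i)

-- The subgraph of G induced by S, with its vertices renumbered in order.
_[_] : Graph n → (S : Subset n) → Graph ∣ S ∣
G [ S ] = record
  { Adj        = λ i j → Adj G (element S i) (element S j)
  ; adj?       = λ i j → adj? G (element S i) (element S j)
  ; adj-sym    = adj-sym G
  ; adj-irrefl = adj-irrefl G
  }

-- The vertex set of the component containing r.
IsComponent : Graph n → Subset n → Set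
IsComponent G C = ∃[ r ] ∀ v → v ∈ C ⇔ Star (Adj G) r v

IsGreatest IsLeast : Pred ℕ 0ℓ → Pred ℕ 0ℓ
IsGreatest P k = P k × (∀ j → P j → j ≤ k)
IsLeast    P k = P k × (∀ j → P j → k ≤ j)

greatest : ∀ {P} → Decidable₁ P → P 0 → ∀ b → (∀ j → P j → j ≤ b) → ∃ (IsGreatest P)
greatest P? p₀ zero    ub = 0 , p₀ , ub
greatest P? p₀ (suc b) ub with P? (suc b)
... | yes p = suc b , p , ub
... | no ¬p = greatest P? p₀ b λ j pj →
  m<1+n⇒m≤n (≤∧≢⇒< (ub j pj) λ { refl → ¬p pj })

least : ∀ {P} → Decidable₁ P → ∀ b → P b → ∃ (IsLeast P)
least P? zero    p = 0 , p , λ _ _ → z≤n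
least {P} P? (suc b) p with P? 0
... | yes p₀ = 0 , p₀ , λ _ _ → z≤n
... | no ¬p₀ with least (P? ∘ suc) b p
...   | k , pk , k-min = suc k , pk , λ
        { zero    p₀ → contradiction p₀ ¬p₀
        ; (suc j) pj → s≤s (k-min j pj) }

module _ (G : Graph n) where

  IsClique : Subset n → Set
  IsClique S = ∀ u v → u ∈ S → v ∈ S → u ≢ v → Adj G u v

  isClique? : Decidable₁ IsClique
  isClique? S = all? λ u → all? λ v →
    u ∈? S →-dec (v ∈? S →-dec (¬? (u ≟ᶠ v) →-dec adj? G u v))

  HasClique : ℕ → Set
  HasClique k = ∃[ S ] IsClique S × ∣ S ∣ ≡ k

  hasClique? : Decidable₁ HasClique
  hasClique? k = anySubset? λ S → isClique? S ×-dec (∣ S ∣ ≟ⁿ k)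

  cliqueNumber : ∃ (IsGreatest HasClique)
  cliqueNumber = greatest hasClique?
    (∅ , (λ _ _ u∈∅ → contradiction u∈∅ ∉⊥) , ∣⊥∣≡0 n)
    n λ { _ (S , _ , refl) → ∣p∣≤n S }

  ω : ℕ
  ω = proj₁ cliqueNumber

  IsProper : ∀ {k} → (Fin n → Fin k) → Set
  IsProper c = ∀ u v → Adj G u v → c u ≢ c v

  isProper? : ∀ {k} → Decidable₁ (IsProper {k})
  isProper? c = all? λ u → all? λ v → adj? G u v →-dec ¬? (c u ≟ᶠ c v)

  Colourable : ℕ → Set
  Colourable k = ∃[ c ] IsProper {k} c

  -- Colourings are searched through their codes in Fin (k ^ n).
  colourable? : Decidable₁ Colourable
  colourable? k = map′
    (λ (i , proper) → finToFun i , proper)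
    (λ (c , proper) → funToFin c , λ u v e →
        subst₂ _≢_ (sym (finToFun-funToFin c u)) (sym (finToFun-funToFin c v)) (proper u v e))
    (any? {n = k ^ n} (isProper? ∘ finToFun))

  chromaticNumber : ∃ (IsLeast Colourable)
  chromaticNumber = least colourable? n
    (id , λ u v e u≡v → adj-irrefl G (subst (Adj G u) (sym u≡v) e))

  χ : ℕ
  χ = proj₁ chromaticNumber

{-# OPTIONS --safe #-}
module Submission where

-- Treat a component at a time; let a be a maximum clique of it, of size ω ≥ 3. Freeness of butterflies
-- and hammers together with connectedness makes the set of vertices that miss both a i and a j
-- independent, for all i ≠ j. If ω ≤ p + 1, colour such sets separately (at most p (p + 1) / 2
-- colours); every other vertex misses exactly one a i and gets colour i.
-- If ω ≥ p + 2, only use the pairs among the first p + 2 clique vertices. A vertex that misses at most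
-- one of these, and at least two clique vertices in all, misses some later a i and gets colour i: two
-- adjacent such vertices would give a C₄ + K_p. For the same reason the vertices that miss exactly one
-- clique vertex form an independent set, which needs one colour. Since the vertices that miss a i may
-- reuse its colour, p + 2 of the C(p + 2, 2) pairs are coloured for free, and
-- C(p + 2, 2) - (p + 2) + 1 = p (p + 1) / 2.

open import Defs
open import Data.Nat using (ℕ; NonZero; _+_; _*_; _/_; _≤_)
open import Data.Fin.Subset using (Subset)
open import Data.List using ([]; _∷_)
open import Data.Product using (_,_)
open import Relation.Binary.PropositionalEquality using (_≢_)

open import Data.Bool.Base using (if_then_else_)
open import Data.Empty using (⊥; ⊥-elim)
open import Data.Fin.Base using (Fin; zero; suc; toℕ; fromℕ<; inject≤; punchIn; punchOut; splitAt) renaming (join to joinᶠ)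
open import Data.Fin.Patterns using (0F; 1F; 2F; 3F)
open import Data.Fin.Properties using (any?; _≟_; toℕ-injective; toℕ-fromℕ<; toℕ<n; toℕ-inject≤; inject≤-injective; injective⇒≤; join-splitAt; punchIn-injective; punchIn-punchOut; punchInᵢ≢i; sequence; splitAt-join; suc-injective; ¬∀⟶∃¬)
open import Data.Fin.Subset using (inside; outside; _∈_; ∣_∣)
open import Data.Fin.Subset.Properties using (⊆-antisym)
open import Data.List.Relation.Unary.All using ([]; _∷_)
open import Data.Nat.Base using (zero; suc; _<_; z≤n; s≤s; s≤s⁻¹)
open import Data.Nat.DivMod using (m*n/n≡m)
open import Data.Nat.Properties using (≤-refl; ≤-trans; ≤-reflexive; <-cmp; <-irrefl; <-≤-trans; <⇒≱; n≤1+n; m≤m+n; ≰⇒>; ≮⇒≥; +-monoʳ-<; +-mono-≤; +-monoˡ-≤; +-cancelˡ-≡; 1+n≢n; 1+n≰n; 0≢1+n; n<1+n; ≤∧≢⇒<; _≤?_; _<?_)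
  renaming (_≟_ to _≟ℕ_)
open import Data.Nat.Solver using (module +-*-Solver)
open import Data.Product.Base using (∃; ∃-syntax; _×_; proj₁; proj₂)
open import Data.Sum.Base using (_⊎_; inj₁; inj₂; [_,_]′)
import Data.Vec.Functional as F
open import Data.Vec.Base as Vec using ([]; _∷_; here; there)
open import Data.Vec.Properties using (lookup∘tabulate; lookup⇒[]=; []=⇒lookup)
open import Data.Vec.Relation.Unary.All using ([]; _∷_)
open import Data.Vec.Relation.Unary.All.Properties using (tabulate⁻)
open import Data.Vec.Relation.Unary.AllPairs using (AllPairs; []; _∷_)
open import Function.Base using (_∘_; id)
open import Function.Bundles using (_⇔_; mk⇔; Equivalence)
open import Function.Definitions using (Injective)
open import Level using (0ℓ)
open import Relation.Binary.Construct.Closure.ReflexiveTransitive as Star using (Star; ε; _◅_; _◅◅_)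
open import Relation.Binary.Core using (Rel)
open import Relation.Binary.Definitions using (Decidable; tri<; tri≈; tri>)
open import Relation.Binary.PropositionalEquality using (_≡_; refl; sym; trans; cong; subst; subst₂; ≢-sym; module ≡-Reasoning)
open import Relation.Nullary.Decidable using (Dec; yes; no; does; ¬?; _×-dec_; dec-true; ¬¬-excluded-middle; decidable-stable)
open import Relation.Nullary.Negation using (¬_; contradiction; ¬¬-map; ¬¬-Monad)
open import Relation.Unary using (Pred) renaming (Decidable to Decidable₁)
open import Effect.Monad using (RawMonad)

private
  variable
    k m n : ℕ

-- Subsets

element-injective : (S : Subset n) → Injective _≡_ _≡_ (element S)
element-injective (inside  ∷ S) {zero}  {zero}  _  = refl
element-injective (inside  ∷ S) {suc i} {suc j} eq = cong suc (element-injective S (suc-injective eq))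
element-injective (outside ∷ S)                 eq = element-injective S (suc-injective eq)

element-∈ : (S : Subset n) (i : Fin ∣ S ∣) → element S i ∈ S
element-∈ (inside  ∷ S) zero    = here
element-∈ (inside  ∷ S) (suc i) = there (element-∈ S i)
element-∈ (outside ∷ S) i       = there (element-∈ S i)

element⁻ : (S : Subset n) {v : Fin n} → v ∈ S → ∃[ i ] element S i ≡ v
element⁻ (inside  ∷ S) here      = zero , refl
element⁻ (inside  ∷ S) (there v∈S) with i , refl ← element⁻ S v∈S = suc i , refl
element⁻ (outside ∷ S) (there v∈S) with i , refl ← element⁻ S v∈S = i , refl

module _ {P : Pred (Fin n) 0ℓ} (P? : Decidable₁ P) where

  filter : Subset n
  filter = Vec.tabulate (does ∘ P?)

  ∈-filter⁺ : ∀ {v} → P v → v ∈ filter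
  ∈-filter⁺ {v} pv = lookup⇒[]= v filter (trans (lookup∘tabulate (does ∘ P?) v) (dec-true (P? v) pv))

  ∈-filter⁻ : ∀ {v} → v ∈ filter → P v
  ∈-filter⁻ {v} v∈ with P? v | trans (sym (lookup∘tabulate (does ∘ P?) v)) ([]=⇒lookup v∈)
  ... | yes pv | _ = pv

-- Induced subgraphs

⊴-trans : ∀ {F : Graph k} {G : Graph m} {H : Graph n} → F ⊴ G → G ⊴ H → F ⊴ H
⊴-trans (f , f-inj , f-adj) (g , g-inj , g-adj) =
  g ∘ f , f-inj ∘ g-inj , λ u v →
    mk⇔ (to (g-adj (f u) (f v)) ∘ to (f-adj u v)) (from (f-adj u v) ∘ from (g-adj (f u) (f v)))
  where open Equivalence

[]-⊴ : (G : Graph n) (S : Subset n) → (G [ S ]) ⊴ G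
[]-⊴ G S = element S , element-injective S , λ _ _ → mk⇔ id id

module _ {R : Rel (Fin k) 0ℓ} where

  allPairs⁻ : {g : Fin m → Fin k} → AllPairs R (Vec.tabulate g) →
              ∀ u v → toℕ u < toℕ v → R (g u) (g v)
  allPairs⁻ (r ∷ _)  zero    (suc v) _   = tabulate⁻ r v
  allPairs⁻ (_ ∷ rs) (suc u) (suc v) u<v = allPairs⁻ rs u v (s≤s⁻¹ u<v)

module _ (H : Graph m) (G : Graph n) (f : Fin m → Fin n) where

  -- Branching on `does` makes the condition compute for a concrete `H`, so an embedding is given by
  -- a table with one entry per unordered pair. Adjacent images are distinct by irreflexivity; for
  -- non-adjacent ones distinctness is demanded.
  SamePair : Rel (Fin m) 0ℓ
  SamePair u v = if does (adj? H u v) then Adj G (f u) (f v) else (¬ Adj G (f u) (f v) × f u ≢ f v)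

  pairs⇒⊴ : AllPairs SamePair (Vec.tabulate id) → H ⊴ G
  pairs⇒⊴ pairs = f , inj , λ u v → mk⇔ (preserves u v) (reflects u v)
    where
    -- Distinctness is conditional on `u ≢ v`, so that the relation also holds on the diagonal.
    Same : Rel (Fin m) 0ℓ
    Same u v = (Adj H u v × Adj G (f u) (f v)) ⊎ (¬ Adj H u v × ¬ Adj G (f u) (f v) × (u ≢ v → f u ≢ f v))

    same< : ∀ u v → toℕ u < toℕ v → Same u v
    same< u v u<v with adj? H u v | allPairs⁻ {R = SamePair} pairs u v u<v
    ... | yes e | r        = inj₁ (e , r)
    ... | no ¬e | (¬r , d) = inj₂ (¬e , ¬r , λ _ → d)

    same : ∀ u v → Same u v
    same u v with <-cmp (toℕ u) (toℕ v)
    ... | tri< u<v _ _ = same< u v u<v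
    ... | tri≈ _ u≡v _ with refl ← toℕ-injective u≡v =
      inj₂ (adj-irrefl H , adj-irrefl G , λ u≢u → contradiction refl u≢u)
    ... | tri> _ _ v<u with same< v u v<u
    ...   | inj₁ (e , r)       = inj₁ (adj-sym H e , adj-sym G r)
    ...   | inj₂ (¬e , ¬r , d) = inj₂ (¬e ∘ adj-sym H , ¬r ∘ adj-sym G , λ u≢v → ≢-sym (d (≢-sym u≢v)))

    preserves : ∀ u v → Adj H u v → Adj G (f u) (f v)
    preserves u v e with same u v
    ... | inj₁ (_ , r)  = r
    ... | inj₂ (¬e , _) = contradiction e ¬e

    reflects : ∀ u v → Adj G (f u) (f v) → Adj H u v
    reflects u v r with same u v
    ... | inj₁ (e , _)      = e
    ... | inj₂ (_ , ¬r , _) = contradiction r ¬r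

    inj : Injective _≡_ _≡_ f
    inj {u} {v} eq with u ≟ v | same u v
    ... | yes u≡v | _                = u≡v
    ... | no _    | inj₁ (_ , r)     = contradiction (subst (Adj G (f u)) (sym eq) r) (adj-irrefl G)
    ... | no u≢v  | inj₂ (_ , _ , d) = contradiction eq (d u≢v)

join-⊴ : ∀ {H₁ : Graph k} {H₂ : Graph m} {G : Graph n} ((f , _) : H₁ ⊴ G) ((g , _) : H₂ ⊴ G) →
         (∀ u v → Adj G (f u) (g v)) → join H₁ H₂ ⊴ G
join-⊴ {k} {m} {H₁ = H₁} {H₂} {G} (f , f-inj , f-adj) (g , g-inj , g-adj) fg =
  h ∘ splitAt k , inj , λ u v → adj (splitAt k u) (splitAt k v)
  where
  h = [ f , g ]′

  adj : ∀ s t → JoinAdj H₁ H₂ s t ⇔ Adj G (h s) (h t)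
  adj (inj₁ u) (inj₁ v) = f-adj u v
  adj (inj₁ u) (inj₂ v) = mk⇔ (λ _ → fg u v) _
  adj (inj₂ u) (inj₁ v) = mk⇔ (λ _ → adj-sym G (fg v u)) _
  adj (inj₂ u) (inj₂ v) = g-adj u v

  f≢g : ∀ u v → f u ≢ g v
  f≢g u v eq = adj-irrefl G (subst (Adj G (f u)) (sym eq) (fg u v))

  h-inj : ∀ s t → h s ≡ h t → s ≡ t
  h-inj (inj₁ u) (inj₁ v) eq = cong inj₁ (f-inj eq)
  h-inj (inj₁ u) (inj₂ v) eq = contradiction eq (f≢g u v)
  h-inj (inj₂ u) (inj₁ v) eq = contradiction (sym eq) (f≢g v u)
  h-inj (inj₂ u) (inj₂ v) eq = cong inj₂ (g-inj eq)

  inj : Injective _≡_ _≡_ (h ∘ splitAt k)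
  inj {u} {v} eq = begin
    u                          ≡⟨ join-splitAt k m u ⟨
    joinᶠ k m (splitAt k u)    ≡⟨ cong (joinᶠ k m) (h-inj (splitAt k u) (splitAt k v) eq) ⟩
    joinᶠ k m (splitAt k v)    ≡⟨ join-splitAt k m v ⟩
    v                          ∎
    where open ≡-Reasoning

-- Cliques

IsCliqueFamily : Graph n → (Fin k → Fin n) → Set
IsCliqueFamily G a = ∀ {i j} → i ≢ j → Adj G (a i) (a j)

module _ (G : Graph n) where

  family-injective : {a : Fin k → Fin n} → IsCliqueFamily G a → Injective _≡_ _≡_ a
  family-injective {a = a} clique {i} {j} eq with i ≟ j
  ... | yes i≡j = i≡j
  ... | no  i≢j = contradiction (subst (Adj G (a i)) (sym eq) (clique i≢j)) (adj-irrefl G)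

  family⇒K : {a : Fin k → Fin n} → IsCliqueFamily G a → K k ⊴ G
  family⇒K {a = a} clique = a , family-injective clique , λ i j →
    mk⇔ clique (λ e → λ { refl → adj-irrefl G e })

  singleton-clique : ∀ v → IsCliqueFamily {k = 1} G (λ _ → v)
  singleton-clique v {0F} {0F} 0≢0 = contradiction refl 0≢0

  cons-clique : {x : Fin n} {a : Fin k → Fin n} → IsCliqueFamily G a →
                (∀ i → Adj G x (a i)) → IsCliqueFamily G (x F.∷ a)
  cons-clique clique x~ {zero}  {zero}  0≢0 = contradiction refl 0≢0
  cons-clique clique x~ {zero}  {suc j} _   = x~ j
  cons-clique clique x~ {suc i} {zero}  _   = adj-sym G (x~ i)
  cons-clique clique x~ {suc i} {suc j} i≢j = clique (i≢j ∘ cong suc)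

  -- The image `S` of `a` is a clique into which `index` injects `Fin k`, so `k ≤ ∣ S ∣ ≤ ω G`.
  family⇒≤ω : {a : Fin k → Fin n} → IsCliqueFamily G a → k ≤ ω G
  family⇒≤ω {k} {a} clique =
    ≤-trans (injective⇒≤ {f = index} index-inj) (proj₂ (proj₂ (cliqueNumber G)) ∣ S ∣ (S , S-clique , refl))
    where
    inImage? = λ v → any? λ i → a i ≟ v
    S = filter inImage?
    index : Fin k → Fin ∣ S ∣
    index i = proj₁ (element⁻ S (∈-filter⁺ inImage? (i , refl)))
    index-inj : Injective _≡_ _≡_ index
    index-inj {i} {j} eq = family-injective clique (begin
      a i                  ≡⟨ proj₂ (element⁻ S (∈-filter⁺ inImage? (i , refl))) ⟨
      element S (index i)  ≡⟨ cong (element S) eq ⟩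
      element S (index j)  ≡⟨ proj₂ (element⁻ S (∈-filter⁺ inImage? (j , refl))) ⟩
      a j                  ∎)
      where open ≡-Reasoning
    S-clique : IsClique G S
    S-clique u v u∈ v∈ u≢v with ∈-filter⁻ inImage? u∈ | ∈-filter⁻ inImage? v∈
    ... | i , refl | j , refl = clique (u≢v ∘ cong a)

  hasClique⇒family : HasClique G k → ∃[ a ] IsCliqueFamily {k = k} G a
  hasClique⇒family (S , clique , refl) =
    element S , λ {i} {j} i≢j → clique _ _ (element-∈ S i) (element-∈ S j) (i≢j ∘ element-injective S)

  ω-family : ∃[ a ] IsCliqueFamily {k = ω G} G a
  ω-family = hasClique⇒family (proj₁ (proj₂ (cliqueNumber G)))

ω-mono : {H : Graph m} {G : Graph n} → H ⊴ G → ω H ≤ ω G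
ω-mono {H = H} {G} (f , _ , f-adj) with a , clique ← ω-family H =
  family⇒≤ω G {a = f ∘ a} λ i≢j → Equivalence.to (f-adj _ _) (clique i≢j)

-- Forbidden subgraphs in terms of their vertices

module _ (G : Graph n) where
  private
    _~_ _≁_ : Rel (Fin n) 0ℓ
    u ~ v = Adj G u v
    u ≁ v = ¬ Adj G u v

  -- Yields the inequalities that `SamePair` demands: a third vertex sees only one of the two.
  separated : ∀ {w u v} → w ~ u → w ≁ v → u ≢ v
  separated w~u w≁v refl = w≁v w~u

  -- Every pair except `c`, `e` is as in the hammer with triangle `a b c` and tail `c d e`, so a
  -- non-edge `c e` would complete it.
  hammer⁻ : ¬ (hammer ⊴ G) → ∀ {a b c d e} → a ~ b → a ~ c → b ~ c → c ~ d → d ~ e →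
            a ≁ d → b ≁ d → a ≁ e → b ≁ e → c ~ e
  hammer⁻ free {a} {b} {c} {d} {e} ab ac bc cd de ad bd ae be = decidable-stable (adj? G c e) λ ce →
    free (pairs⇒⊴ hammer G (Vec.lookup (a ∷ b ∷ c ∷ d ∷ e ∷ [])) (
      (ab ∷ ac ∷ (ad , separated (adj-sym G ab) bd) ∷ (ae , separated (adj-sym G ab) be) ∷ []) ∷
      (bc ∷ (bd , separated ab ad) ∷ (be , separated ab ae) ∷ []) ∷
      (cd ∷ (ce , separated ac ae) ∷ []) ∷
      (de ∷ []) ∷ [] ∷ []))

  butterfly⁻ : ¬ (butterfly ⊴ G) → ∀ {a b c d e} → a ~ b → a ~ c → b ~ c → c ~ d → d ~ e → c ~ e →
               a ≁ d → b ≁ d → a ≁ e → ¬ (b ≁ e)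
  butterfly⁻ free {a} {b} {c} {d} {e} ab ac bc cd de ce ad bd ae be =
    free (pairs⇒⊴ butterfly G (Vec.lookup (a ∷ b ∷ c ∷ d ∷ e ∷ [])) (
      (ab ∷ ac ∷ (ad , separated (adj-sym G ab) bd) ∷ (ae , separated (adj-sym G ab) be) ∷ []) ∷
      (bc ∷ (bd , separated ab ad) ∷ (be , separated ab ae) ∷ []) ∷
      (cd ∷ ce ∷ []) ∷
      (de ∷ []) ∷ [] ∷ []))

  C₄+K⁻ : ¬ (join C₄ (K m) ⊴ G) → ∀ {w x y z} → w ~ x → x ~ y → y ~ z → w ~ z →
          w ≁ y → w ≢ y → x ≁ z → x ≢ z →
          {q : Fin m → Fin n} → IsCliqueFamily G q →
          (∀ t → w ~ q t) → (∀ t → x ~ q t) → (∀ t → y ~ q t) → ¬ (∀ t → z ~ q t)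
  C₄+K⁻ free {w} {x} {y} {z} wx xy yz wz wy w≢y xz x≢z clique wq xq yq zq =
    free (join-⊴ {G = G} c₄ (family⇒K G clique) λ { 0F → wq ; 1F → xq ; 2F → yq ; 3F → zq })
    where
    c₄ = pairs⇒⊴ C₄ G (Vec.lookup (w ∷ x ∷ y ∷ z ∷ [])) (
      (wx ∷ (wy , w≢y) ∷ wz ∷ []) ∷
      (xy ∷ (xz , x≢z) ∷ []) ∷
      (yz ∷ []) ∷ [] ∷ [])

-- Colourings

colourable⇒χ≤ : {G : Graph n} → Colourable G k → χ G ≤ k
colourable⇒χ≤ {k = k} {G} = proj₂ (proj₂ (chromaticNumber G)) k

-- `Class` is a relation because a vertex may qualify for several colours; `total` picks one. The
-- left summand holds the colours of the clique vertices, the right one the additional colours.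
by-classes : (G : Graph n) (Class : Fin n → Fin k ⊎ Fin m → Set) → (∀ x → ∃ (Class x)) →
             (∀ {x y c} → Class x c → Class y c → ¬ Adj G x y) → Colourable G (k + m)
by-classes {k = k} {m} G Class total indep = joinᶠ k m ∘ proj₁ ∘ total , λ u v uv eq →
  indep (proj₂ (total u)) (subst (Class v) (sym (join-inj eq)) (proj₂ (total v))) uv
  where
  join-inj : ∀ {s t} → joinᶠ k m s ≡ joinᶠ k m t → s ≡ t
  join-inj {s} {t} eq = trans (sym (splitAt-join k m s)) (trans (cong (splitAt k) eq) (splitAt-join k m t))

-- Triangular numbers and the numbering of pairs

triangle : ℕ → ℕ
triangle zero    = 0
triangle (suc m) = triangle m + suc m

triangle*2 : ∀ m → triangle m * 2 ≡ m * (m + 1)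
triangle*2 zero    = refl
triangle*2 (suc m) = begin
  (triangle m + suc m) * 2      ≡⟨ solve 2 (λ t m → (t :+ (con 1 :+ m)) :* con 2 := t :* con 2 :+ (con 1 :+ m) :* con 2) refl (triangle m) m ⟩
  triangle m * 2 + suc m * 2    ≡⟨ cong (_+ suc m * 2) (triangle*2 m) ⟩
  m * (m + 1) + suc m * 2       ≡⟨ solve 1 (λ m → m :* (m :+ con 1) :+ (con 1 :+ m) :* con 2 := (con 1 :+ m) :* (con 1 :+ m :+ con 1)) refl m ⟩
  suc m * (suc m + 1)           ∎
  where
  open ≡-Reasoning
  open +-*-Solver

triangle-closed : ∀ m → triangle m ≡ (m * (m + 1)) / 2
triangle-closed m = trans (sym (m*n/n≡m (triangle m) 2)) (cong (_/ 2) (triangle*2 m))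

triangle-mono : m ≤ n → triangle m ≤ triangle n
triangle-mono z≤n       = z≤n
triangle-mono (s≤s m≤n) = +-mono-≤ (triangle-mono m≤n) (s≤s m≤n)

-- The pairs i ≤ j < m are numbered by triangle j + i < triangle m.
pair<triangle : ∀ {i j} → i ≤ j → j < m → triangle j + i < triangle m
pair<triangle {j = j} i≤j j<m = <-≤-trans (+-monoʳ-< (triangle j) (s≤s i≤j)) (triangle-mono j<m)

pair-code : ∀ {i j} → i ≤ j → j < m → ∃[ c ] toℕ {triangle m} c ≡ triangle j + i
pair-code i≤j j<m = fromℕ< (pair<triangle i≤j j<m) , toℕ-fromℕ< (pair<triangle i≤j j<m)

-- The codes with larger entry `j` lie in the interval from `triangle j` up to but excluding
-- `triangle (suc j)`, and these intervals are disjoint.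
pair-unique : ∀ {i j i′ j′} → i ≤ j → i′ ≤ j′ → triangle j + i ≡ triangle j′ + i′ → j ≡ j′ × i ≡ i′
pair-unique {i} {j} {i′} {j′} i≤j i′≤j′ eq with <-cmp j j′
... | tri≈ _ refl _ = refl , +-cancelˡ-≡ (triangle j) i i′ eq
... | tri< j<j′ _ _ = contradiction
  (<-≤-trans (pair<triangle i≤j j<j′) (m≤m+n (triangle j′) i′)) (<-irrefl eq)
... | tri> _ _ j′<j = contradiction
  (<-≤-trans (pair<triangle i′≤j′ j′<j) (m≤m+n (triangle j) i)) (<-irrefl (sym eq))

avoid₂ : (i j : Fin (2 + m)) →
         ∃[ g ] Injective {A = Fin m} _≡_ _≡_ g × (∀ t → g t ≢ i) × (∀ t → g t ≢ j)
avoid₂ {m} i j with i ≟ j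
... | no i≢j = distinct i≢j
  where
  distinct : ∀ {i j : Fin (2 + m)} → i ≢ j →
             ∃[ g ] Injective {A = Fin m} _≡_ _≡_ g × (∀ t → g t ≢ i) × (∀ t → g t ≢ j)
  distinct {i} i≢j =
    -- `punchOut i≢j` is the position of `j` once `i` is removed.
    (λ t → punchIn i (punchIn (punchOut i≢j) t)) ,
    (λ eq → punchIn-injective _ _ _ (punchIn-injective i _ _ eq)) ,
    (λ t → punchInᵢ≢i i _) ,
    (λ t eq → punchInᵢ≢i (punchOut i≢j) t (punchIn-injective i _ _ (trans eq (sym (punchIn-punchOut i≢j)))))
... | yes refl =
  -- Only one index has to be avoided here; `suc` drops a further one to leave `m`.
  (λ t → punchIn i (suc t)) , (λ eq → suc-injective (punchIn-injective i _ _ eq)) ,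
  (λ t → punchInᵢ≢i i _) , (λ t → punchInᵢ≢i i _)

-- Graphs with a fixed maximum clique

module MaximumClique
  (G : Graph n) {k} (a : Fin k → Fin n) (clique : IsCliqueFamily G a)
  (maximum : ∀ {b : Fin (suc k) → Fin n} → ¬ IsCliqueFamily G b)
  where

  infix 4 _~_ _⁓_ _≁_ _≁?_

  _~_ : Rel (Fin n) 0ℓ
  _~_ = Adj G

  _⁓_ _≁_ : Fin n → Fin k → Set
  x ⁓ i = x ~ a i
  x ≁ i = ¬ x ⁓ i

  _≁?_ : ∀ x i → Dec (x ≁ i)
  x ≁? i = ¬? (adj? G x (a i))

  ⁓-stable : ∀ {x i} → ¬ (x ≁ i) → x ⁓ i
  ⁓-stable {x} {i} = decidable-stable (adj? G x (a i))

  ~-sym : ∀ {x y} → x ~ y → y ~ x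
  ~-sym = adj-sym G

  self-≁ : ∀ {x i} → x ≡ a i → x ≁ i
  self-≁ refl = adj-irrefl G

  distinct : ∀ {x i j} → x ⁓ i → x ≁ j → i ≢ j
  distinct x⁓i x≁j refl = x≁j x⁓i

  -- A vertex adjacent to the whole clique would enlarge it; a clique vertex misses itself.
  nonneighbour : ∀ x → ∃[ i ] x ≁ i
  nonneighbour x = ¬∀⟶∃¬ k (x ⁓_) (adj? G x ∘ a) (maximum ∘ cons-clique G clique)

  Single : Fin n → Fin k → Set
  Single x i = x ≁ i × ∀ {j} → j ≢ i → x ⁓ j

  single-≡ : ∀ {x i j} → Single x i → x ≁ j → i ≡ j
  single-≡ {i = i} {j} (_ , x⁓) x≁j with j ≟ i
  ... | yes refl = refl
  ... | no j≢i   = contradiction (x⁓ j≢i) x≁j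

  -- Otherwise a clique could be enlarged by replacing its i-th vertex with x and y.
  single-independent : ∀ {x y i} → Single x i → Single y i → ¬ (x ~ y)
  single-independent {x} {y} {i} (_ , x⁓) (_ , y⁓) xy = maximum (cons-clique G {x = y} swapped y~)
    where
    b : Fin k → Fin n
    b j with j ≟ i
    ... | yes _ = x
    ... | no  _ = a j
    swapped : IsCliqueFamily G b
    swapped {j} {l} j≢l with j ≟ i | l ≟ i
    ... | yes refl | yes refl = contradiction refl j≢l
    ... | yes refl | no l≢i   = x⁓ l≢i
    ... | no j≢i   | yes refl = ~-sym (x⁓ j≢i)
    ... | no _     | no _     = clique j≢l
    y~ : ∀ j → y ~ b j
    y~ j with j ≟ i
    ... | yes _  = ~-sym xy
    ... | no j≢i = y⁓ j≢i

  MissesBoth : Fin n → Fin k → Fin k → Set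
  MissesBoth x i j = x ≁ i × x ≁ j

  -- For connected graphs `missing-independent` supplies this; butterflies and hammers enter the
  -- colouring only through it.
  module _ (independent : ∀ {x y i j} → i ≢ j → MissesBoth x i j → MissesBoth y i j → ¬ (x ~ y)) where

    -- A pair `i < j` is coded through `j′ = j - 1`; then `i ≤ j′ < p` when `k ≤ suc p`, which fits
    -- `triangle p` codes.
    data SmallClass (p : ℕ) (x : Fin n) : Fin k ⊎ Fin (triangle p) → Set where
      pair   : ∀ {i j j′ c} → toℕ i ≤ j′ → toℕ j ≡ suc j′ → toℕ c ≡ triangle j′ + toℕ i →
               MissesBoth x i j → SmallClass p x (inj₂ c)
      single : ∀ {i} → Single x i → SmallClass p x (inj₁ i)

    -- If ω ≤ p + 1, there are at most p (p + 1) / 2 pairs of clique vertices.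
    colourable-small : ∀ {p} → k ≤ suc p → Colourable G (k + triangle p)
    colourable-small {p} k≤ = by-classes G (SmallClass p) total indep
      where
      total : ∀ x → ∃ (SmallClass p x)
      total x with any? (λ i → any? λ j → (toℕ i <? toℕ j) ×-dec (x ≁? i) ×-dec (x ≁? j))
      ... | yes (i , suc j , s≤s i≤j , misses) =
        let c , c≡ = pair-code i≤j (s≤s⁻¹ (≤-trans (toℕ<n (suc j)) k≤))
        in inj₂ c , pair i≤j refl c≡ misses
      ... | no none = let i , x≁i = nonneighbour x in
        inj₁ i , single (x≁i , λ {j} j≢i → ⁓-stable λ x≁j → case-cmp i j x≁i x≁j j≢i)
        where
        case-cmp : ∀ i j → x ≁ i → x ≁ j → ¬ (j ≢ i)
        case-cmp i j x≁i x≁j j≢i with <-cmp (toℕ i) (toℕ j)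
        ... | tri< i<j _ _ = none (i , j , i<j , x≁i , x≁j)
        ... | tri≈ _ i≡j _ = j≢i (sym (toℕ-injective i≡j))
        ... | tri> _ _ j<i = none (j , i , j<i , x≁j , x≁i)

      indep : ∀ {x y c} → SmallClass p x c → SmallClass p y c → ¬ (x ~ y)
      indep (single sx) (single sy) = single-independent sx sy
      indep (pair {i} {j} i≤j′ j≡ c≡ mx) (pair l≤m′ m≡ c≡′ my)
        with refl , i≡l ← pair-unique i≤j′ l≤m′ (trans (sym c≡) c≡′)
        with refl ← toℕ-injective i≡l | refl ← toℕ-injective (trans j≡ (sym m≡)) =
        independent (λ { refl → <-irrefl refl (≤-trans (s≤s i≤j′) (≤-reflexive (sym j≡))) }) mx my

    -- Colouring when the maximum clique has at least p + 2 vertices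

    module _ (q : ℕ) (free : ¬ (join C₄ (K (suc q)) ⊴ G)) (2+p≤k : 3 + q ≤ k) where

      p : ℕ
      p = suc q

      Front : Fin k → Set
      Front i = toℕ i < 2 + p

      front : Fin (2 + p) → Fin k
      front i = inject≤ i 2+p≤k

      front-Front : ∀ i → Front (front i)
      front-Front i = subst (_< 2 + p) (sym (toℕ-inject≤ i 2+p≤k)) (toℕ<n i)

      Outside : Fin n → Set
      Outside x = ∀ i → x ≢ a i

      -- At most one front vertex is missed: the exceptional `i` may be a neighbour as well.
      MissesOnlyFront : Fin n → Set
      MissesOnlyFront x = ∃[ i ] ∀ t → t ≢ i → x ⁓ front t

      -- Two of the p + 2 front vertices may be missed, which leaves p common neighbours.
      no-C₄ : ∀ {x y i j} → Outside x → Outside y → MissesOnlyFront x → MissesOnlyFront y →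
              x ≁ i → y ⁓ i → y ≁ j → x ⁓ j → ¬ (x ~ y)
      no-C₄ {x} {y} {i} {j} x∉ y∉ (s , x⁓) (t , y⁓) x≁i y⁓i y≁j x⁓j xy
        with g , g-inj , g≢s , g≢t ← avoid₂ s t =
        C₄+K⁻ G free xy y⁓i (clique (distinct y⁓i y≁j)) x⁓j x≁i (x∉ i) y≁j (y∉ j)
          {q = a ∘ front ∘ g}
          (λ u≢v → clique (u≢v ∘ g-inj ∘ inject≤-injective 2+p≤k 2+p≤k _ _))
          (λ u → x⁓ (g u) (g≢s u))
          (λ u → y⁓ (g u) (g≢t u))
          -- The chosen front vertices differ from `a i`, which `x` misses, and from `a j`, which
          -- `y` misses.
          (λ u → clique (≢-sym (distinct (x⁓ (g u) (g≢s u)) x≁i)))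
          (λ u → clique (≢-sym (distinct (y⁓ (g u) (g≢t u)) y≁j)))

      -- C(p + 2, 2) pairs of front vertices exceed p (p + 1) / 2 by p + 1. So the pairs (i , i + 1)
      -- and (0 , p + 1) share the colour of a clique vertex that they miss, namely i and p + 1,
      -- which leaves one colour for the single vertices.
      data LargeClass (x : Fin n) : Fin k ⊎ Fin (triangle p) → Set where
        self        : ∀ {i} → x ≡ a i → LargeClass x (inj₁ i)
        consecutive : ∀ {i j} → toℕ j ≡ suc (toℕ i) → toℕ i ≤ p → MissesBoth x i j → LargeClass x (inj₁ i)
        extreme     : ∀ {i j} → toℕ i ≡ 0 → toℕ j ≡ suc p → MissesBoth x j i → LargeClass x (inj₁ j)
        back        : ∀ {i j} → Outside x → MissesOnlyFront x → 2 + p ≤ toℕ i → j ≢ i → MissesBoth x i j →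
                      LargeClass x (inj₁ i)
        -- Without the consecutive pairs `j ≥ i + 2`, so `j′ = j - 2` stays below `p` and
        -- `triangle p` codes suffice.
        pair        : ∀ {i j j′ c} → toℕ i ≤ j′ → toℕ j ≡ 2 + j′ → ¬ (toℕ i ≡ 0 × j′ ≡ q) →
                      toℕ c ≡ triangle j′ + toℕ i → MissesBoth x i j → LargeClass x (inj₂ c)
        -- `triangle q + 0` is the code of `i = 0`, `j′ = q`, that is of the pair (0 , p + 1), which
        -- `pair` excludes.
        single      : ∀ {i c} → Outside x → Single x i → toℕ c ≡ triangle q + 0 → LargeClass x (inj₂ c)

      misses-front : ∀ {x} → (∀ {i j} → toℕ i < toℕ j → Front j → ¬ MissesBoth x i j) → MissesOnlyFront x
      misses-front {x} none with any? (λ t → x ≁? front t)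
      -- No front vertex is missed, so `zero` is an arbitrary exceptional index.
      ... | no all = zero , λ t _ → ⁓-stable (all ∘ (t ,_))
      ... | yes (i , x≁i) = i , λ t t≢i → ⁓-stable (λ x≁t → by-cmp t t≢i x≁t)
        where
        mono : ∀ {s t} → toℕ s < toℕ t → toℕ (front s) < toℕ (front t)
        mono = subst₂ _<_ (sym (toℕ-inject≤ _ 2+p≤k)) (sym (toℕ-inject≤ _ 2+p≤k))
        by-cmp : ∀ t → t ≢ i → ¬ (x ≁ front t)
        by-cmp t t≢i x≁t with <-cmp (toℕ t) (toℕ i)
        ... | tri< t<i _ _ = none (mono t<i) (front-Front i) (x≁t , x≁i)
        ... | tri≈ _ t≡i _ = t≢i (toℕ-injective t≡i)
        ... | tri> _ _ i<t = none (mono i<t) (front-Front t) (x≁i , x≁t)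

      single-misses-front : ∀ {x i} → Single x i → MissesOnlyFront x
      single-misses-front {x} s = misses-front λ i<j _ (x≁i , x≁j) →
        <-irrefl (cong toℕ (trans (sym (single-≡ s x≁i)) (single-≡ s x≁j))) i<j

      -- The order of the tests matters: failing the first gives `Outside`, failing the second gives
      -- `MissesOnlyFront`, and failing all three leaves exactly one missed clique vertex.
      large-total : ∀ x → ∃ (LargeClass x)
      large-total x with any? (λ i → x ≟ a i)
      ... | yes (i , x≡) = inj₁ i , self x≡
      ... | no x∉
        with any? (λ i → any? λ j → (toℕ i <? toℕ j) ×-dec (toℕ j <? 2 + p) ×-dec (x ≁? i) ×-dec (x ≁? j))
      ...   | yes (i , j , i<j , j∈F , x≁i , x≁j) = front-pair i j i<j j∈F (x≁i , x≁j)
        where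
        front-pair : ∀ i j → toℕ i < toℕ j → Front j → MissesBoth x i j → ∃ (LargeClass x)
        front-pair i j i<j j∈F misses with toℕ j ≟ℕ suc (toℕ i)
        ... | yes j≡ = inj₁ i , consecutive j≡ (s≤s⁻¹ (≤-trans i<j (s≤s⁻¹ j∈F))) misses
        ... | no j≢ with (toℕ i ≟ℕ 0) ×-dec (toℕ j ≟ℕ suc p)
        ...   | yes (i≡0 , j≡) = inj₁ j , extreme i≡0 j≡ (proj₂ misses , proj₁ misses)
        ...   | no ¬extreme with toℕ j in j≡ | ≤∧≢⇒< i<j (≢-sym j≢)
        ...     | suc (suc j′) | s≤s (s≤s i≤j′) =
          let c , c≡ = pair-code i≤j′ (s≤s⁻¹ (s≤s⁻¹ j∈F))
          in inj₂ c , pair i≤j′ j≡ (λ (i≡0 , j′≡) → ¬extreme (i≡0 , cong (2 +_) j′≡)) c≡ misses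
      ...   | no none with any? (λ i → any? λ j → (2 + p ≤? toℕ i) ×-dec ¬? (j ≟ i) ×-dec (x ≁? i) ×-dec (x ≁? j))
      ...     | yes (i , j , i∉F , j≢i , misses) =
        inj₁ i , back (λ i x≡ → x∉ (i , x≡))
                      (misses-front λ i<j j∈F (x≁i , x≁j) → none (_ , _ , i<j , j∈F , x≁i , x≁j))
                      i∉F j≢i misses
      ...     | no none′ with i , x≁i ← nonneighbour x | c , c≡ ← pair-code {m = p} {j = q} z≤n ≤-refl =
        inj₂ c , single {i = i} (λ i x≡ → x∉ (i , x≡)) (x≁i , λ {j} j≢i → ⁓-stable (unique i x≁i j j≢i)) c≡
        where
        unique : ∀ i → x ≁ i → ∀ j → j ≢ i → ¬ (x ≁ j)
        unique i x≁i j j≢i x≁j with toℕ i <? 2 + p | toℕ j <? 2 + p | <-cmp (toℕ i) (toℕ j)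
        ... | no i∉F  | _       | _            = none′ (i , j , ≮⇒≥ i∉F , j≢i , x≁i , x≁j)
        ... | yes _   | no j∉F  | _            = none′ (j , i , ≮⇒≥ j∉F , ≢-sym j≢i , x≁j , x≁i)
        ... | yes _   | yes j∈F | tri< i<j _ _ = none (i , j , i<j , j∈F , x≁i , x≁j)
        ... | yes _   | yes _   | tri≈ _ i≡j _ = j≢i (sym (toℕ-injective i≡j))
        ... | yes i∈F | yes _   | tri> _ _ j<i = none (j , i , j<i , i∈F , x≁j , x≁i)

      -- This is what lets `a i` itself keep colour `i`.
      misses-own : ∀ {x i} → LargeClass x (inj₁ i) → x ≁ i
      misses-own (self x≡)               = self-≁ x≡
      misses-own (consecutive _ _ (m , _)) = m
      misses-own (extreme _ _ (m , _))     = m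
      misses-own (back _ _ _ _ (m , _))    = m

      clash : ∀ {i : Fin k} → toℕ i ≤ p → ¬ (2 + p ≤ toℕ i)
      clash i≤p p<i = <⇒≱ (n<1+n p) (≤-trans (n≤1+n _) (≤-trans p<i i≤p))

      -- Apart from `self`, the kinds that use a clique colour have disjoint ranges: at most `p` for
      -- `consecutive`, `suc p` for `extreme`, at least `2 + p` for `back`.
      large-independent : ∀ {x y c} → LargeClass x c → LargeClass y c → ¬ (x ~ y)
      large-independent (self refl) cy = misses-own cy ∘ ~-sym
      large-independent cx (self refl) = misses-own cx
      large-independent (consecutive j≡ _ mx) (consecutive j′≡ _ my)
        with refl ← toℕ-injective (trans j≡ (sym j′≡)) =
        independent (λ { refl → 1+n≢n (sym j≡) }) mx my
      large-independent (consecutive _ i≤p _) (extreme _ i≡ _) = contradiction (subst (_≤ p) i≡ i≤p) 1+n≰n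
      large-independent (extreme _ i≡ _) (consecutive _ i≤p _) = contradiction (subst (_≤ p) i≡ i≤p) 1+n≰n
      large-independent (consecutive _ i≤p _) (back _ _ i∉F _ _) = contradiction i∉F (clash i≤p)
      large-independent (back _ _ i∉F _ _) (consecutive _ i≤p _) = contradiction i∉F (clash i≤p)
      large-independent (extreme i≡ j≡ mx) (extreme i′≡ _ my)
        with refl ← toℕ-injective (trans i≡ (sym i′≡)) =
        independent (λ { refl → 0≢1+n (trans (sym i≡) j≡) }) mx my
      large-independent (extreme _ j≡ _) (back _ _ i∉F _ _) = contradiction (subst (2 + p ≤_) j≡ i∉F) 1+n≰n
      large-independent (back _ _ i∉F _ _) (extreme _ j≡ _) = contradiction (subst (2 + p ≤_) j≡ i∉F) 1+n≰n
      -- Both vertices miss `i`, so if adjacent they share no second missed vertex. Hence `y ⁓ j`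
      -- and `x ⁓ l`, and `x`, `y`, `a j`, `a l` form an induced 4-cycle.
      large-independent (back {j = j} x∉ fx _ j≢i mx) (back {j = l} y∉ fy _ l≢i my) xy =
        no-C₄ x∉ y∉ fx fy (proj₂ mx)
          (⁓-stable λ y≁j → independent (≢-sym j≢i) mx (proj₁ my , y≁j) xy)
          (proj₂ my)
          (⁓-stable λ x≁l → independent (≢-sym l≢i) (proj₁ mx , x≁l) my xy)
          xy
      large-independent (pair {i} i≤j′ j≡ _ c≡ mx) (pair l≤m′ m≡ _ c≡′ my)
        with refl , i≡l ← pair-unique i≤j′ l≤m′ (trans (sym c≡) c≡′)
        with refl ← toℕ-injective i≡l | refl ← toℕ-injective (trans j≡ (sym m≡)) =
        independent (λ { refl → <⇒≱ (n<1+n _) (≤-trans (n≤1+n _) (≤-trans (≤-reflexive (sym j≡)) i≤j′)) }) mx my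
      large-independent (pair i≤j′ _ ¬extreme c≡ _) (single _ _ c≡′) =
        let j′≡q , i≡0 = pair-unique {j′ = q} i≤j′ z≤n (trans (sym c≡) c≡′) in contradiction (i≡0 , j′≡q) ¬extreme
      large-independent (single _ _ c≡′) (pair i≤j′ _ ¬extreme c≡ _) =
        let j′≡q , i≡0 = pair-unique {j′ = q} i≤j′ z≤n (trans (sym c≡) c≡′) in contradiction (i≡0 , j′≡q) ¬extreme
      large-independent (single {i} x∉ sx _) (single {j} y∉ sy _) xy with i ≟ j
      ... | yes refl = single-independent sx sy xy
      -- Each of the two is adjacent to the clique vertex that the other misses.
      ... | no i≢j   = no-C₄ x∉ y∉ (single-misses-front sx) (single-misses-front sy)
                         (proj₁ sx) (proj₂ sy i≢j) (proj₁ sy) (proj₂ sx (≢-sym i≢j)) xy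

      colourable-large : Colourable G (k + triangle p)
      colourable-large = by-classes G LargeClass large-total large-independent

-- Connected graphs

module _ (G : Graph n) {r} (a : Fin (3 + r) → Fin n) (clique : IsCliqueFamily G a)
         (maximum : ∀ {b : Fin (4 + r) → Fin n} → ¬ IsCliqueFamily G b)
         (butterfly-free : ¬ (butterfly ⊴ G)) (hammer-free : ¬ (hammer ⊴ G))
         (connected : ∀ u v → Star (Adj G) u v)
  where

  open MaximumClique G a clique maximum

  Far : Fin n → Set
  Far x = ∀ i → x ≁ i

  -- If `w` missed two clique vertices besides `a i`, these and `a i` would form a triangle with
  -- tail `w`, `x`; hammer-freeness would then make `a i` adjacent to the far vertex `x`.
  two-neighbours : ∀ {x w i} → Far x → w ~ x → w ⁓ i → ∃[ j ] ∃[ l ] j ≢ l × w ⁓ j × w ⁓ l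
  two-neighbours {x} {w} {i} x-far wx w⁓i with adj? G w (a (punchIn i 0F)) | adj? G w (a (punchIn i 1F))
  ... | yes w⁓j | _       = i , punchIn i 0F , ≢-sym (punchInᵢ≢i i _) , w⁓i , w⁓j
  ... | no _    | yes w⁓j = i , punchIn i 1F , ≢-sym (punchInᵢ≢i i _) , w⁓i , w⁓j
  ... | no w≁j  | no w≁l  = contradiction
    (~-sym (hammer⁻ G hammer-free (clique j≢l) (clique (punchInᵢ≢i i _)) (clique (punchInᵢ≢i i _)) (~-sym w⁓i)
      wx (w≁j ∘ ~-sym) (w≁l ∘ ~-sym) (x-far _ ∘ ~-sym) (x-far _ ∘ ~-sym))) (x-far i)
    where
    j≢l : punchIn i 0F ≢ punchIn i 1F
    j≢l eq with () ← punchIn-injective i 0F 1F eq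

  -- Otherwise `w` and two of its clique neighbours form a triangle that makes a hammer with the
  -- tail `x`, `y`.
  far-neighbours : ∀ {w x y i} → w ⁓ i → w ~ x → x ~ y → Far x → Far y → w ~ y
  far-neighbours w⁓i wx xy x-far y-far with j , l , j≢l , w⁓j , w⁓l ← two-neighbours x-far wx w⁓i =
    hammer⁻ G hammer-free (clique j≢l) (~-sym w⁓j) (~-sym w⁓l) wx xy
      (x-far j ∘ ~-sym) (x-far l ∘ ~-sym) (y-far j ∘ ~-sym) (y-far l ∘ ~-sym)

  Near : Fin n → Set
  Near x = ∃ (x ⁓_) ⊎ ∃[ w ] ∃[ i ] x ~ w × w ⁓ i

  near-or-far : ∀ x → ∃ (x ⁓_) ⊎ Far x
  near-or-far x with any? (λ i → adj? G x (a i))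
  ... | yes near = inj₁ near
  ... | no  far  = inj₂ λ i x⁓i → far (i , x⁓i)

  -- Keeps the distance from the clique at most two along a path. Only an edge between two far
  -- vertices could raise it, and there `far-neighbours` hands `w` on to `y`.
  near-step : ∀ {x y} → x ~ y → Near x → Near y
  near-step xy (inj₁ (i , x⁓i)) = inj₂ (_ , i , ~-sym xy , x⁓i)
  near-step {x} {y} xy (inj₂ (w , i , xw , w⁓i)) with near-or-far x | near-or-far y
  ... | _                | inj₁ y-near = inj₁ y-near
  ... | inj₁ (j , x⁓j)   | inj₂ _      = inj₂ (x , j , ~-sym xy , x⁓j)
  ... | inj₂ x-far       | inj₂ y-far  =
    inj₂ (w , i , ~-sym (far-neighbours w⁓i (~-sym xw) xy x-far y-far) , w⁓i)

  near : ∀ x → Near x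
  near x = walk (connected (a 0F) x) (inj₁ (1F , clique λ ()))
    where
    walk : ∀ {x y} → Star _~_ x y → Near x → Near y
    walk ε        = id
    walk (e ◅ es) = walk es ∘ near-step e

  -- The vertex `w` between `x` and the clique is adjacent to `y` too, so `w x y` and the triangle
  -- of `w` with two clique neighbours form a butterfly.
  far-independent : ∀ {x y} → Far x → Far y → ¬ (x ~ y)
  far-independent {x} x-far y-far xy with near x
  ... | inj₁ (i , x⁓i) = x-far i x⁓i
  ... | inj₂ (w , i , xw , w⁓i) with j , l , j≢l , w⁓j , w⁓l ← two-neighbours x-far (~-sym xw) w⁓i =
    butterfly⁻ G butterfly-free (clique j≢l) (~-sym w⁓j) (~-sym w⁓l) (~-sym xw) xy
      (far-neighbours w⁓i (~-sym xw) xy x-far y-far)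
      (x-far j ∘ ~-sym) (x-far l ∘ ~-sym) (y-far j ∘ ~-sym) (y-far l ∘ ~-sym)

  -- If one of them sees `a l`, the triangle `a i`, `a j`, `a l` and hammer-freeness make the other
  -- see it as well; the two triangles at `a l` then form a butterfly. So both vertices are far.
  missing-independent : ∀ {x y i j} → i ≢ j → MissesBoth x i j → MissesBoth y i j → ¬ (x ~ y)
  missing-independent {x} {y} {i} {j} i≢j (x≁i , x≁j) (y≁i , y≁j) xy =
    far-independent
      (λ l x⁓l → unattached x⁓l (attached xy (x≁i , x≁j) (y≁i , y≁j) x⁓l))
      (λ l y⁓l → unattached (attached (~-sym xy) (y≁i , y≁j) (x≁i , x≁j) y⁓l) y⁓l)
      xy
    where
    attached : ∀ {x y l} → x ~ y → MissesBoth x i j → MissesBoth y i j → x ⁓ l → y ⁓ l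
    attached xy (x≁i , x≁j) (y≁i , y≁j) x⁓l =
      ~-sym (hammer⁻ G hammer-free (clique i≢j) (clique (≢-sym (distinct x⁓l x≁i))) (clique (≢-sym (distinct x⁓l x≁j)))
        (~-sym x⁓l) xy (x≁i ∘ ~-sym) (x≁j ∘ ~-sym) (y≁i ∘ ~-sym) (y≁j ∘ ~-sym))
    unattached : ∀ {l} → x ⁓ l → ¬ (y ⁓ l)
    unattached x⁓l y⁓l =
      butterfly⁻ G butterfly-free (clique i≢j) (clique (≢-sym (distinct x⁓l x≁i))) (clique (≢-sym (distinct x⁓l x≁j)))
        (~-sym x⁓l) xy (~-sym y⁓l) (x≁i ∘ ~-sym) (x≁j ∘ ~-sym) (y≁i ∘ ~-sym) (y≁j ∘ ~-sym)

  colourable : ∀ q → ¬ (join C₄ (K (suc q)) ⊴ G) → Colourable G (3 + r + triangle (suc q))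
  -- With p = `suc q`, the bound `2 + q` is p + 1.
  colourable q free with 3 + r ≤? 2 + q
  ... | yes ω≤ = colourable-small missing-independent ω≤
  ... | no  ω≰ = colourable-large missing-independent q free (≰⇒> ω≰)

-- Clique number 0 means no vertices and 1 means no edges; 2 is excluded, and from 3 on the clique
-- contains the triangles used above.
connected-colourable : (G : Graph n) (a : Fin k → Fin n) → IsCliqueFamily G a →
  (∀ {b : Fin (suc k) → Fin n} → ¬ IsCliqueFamily G b) →
  ¬ (butterfly ⊴ G) → ¬ (hammer ⊴ G) → ¬ (join C₄ (K (suc m)) ⊴ G) →
  (∀ u v → Star (Adj G) u v) → k ≢ 2 → Colourable G (k + triangle (suc m))
connected-colourable {k = 0} G a clique maximum _ _ _ _ _ =
  ⊥-elim ∘ no-vertex , λ u _ _ → ⊥-elim (no-vertex u)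
  where
  no-vertex : ∀ v → ⊥
  no-vertex v = maximum {λ _ → v} (singleton-clique G v)
connected-colourable {k = 1} G a clique maximum _ _ _ _ _ =
  (λ _ → zero) , λ u v uv _ → maximum (cons-clique G {x = u} (singleton-clique G v) (λ _ → uv))
connected-colourable {k = 2} G a clique maximum _ _ _ _ ω≢2 = contradiction refl ω≢2
connected-colourable {k = suc (suc (suc r))} G a clique maximum b-free h-free c-free connected _ =
  colourable G a clique maximum b-free h-free connected _ c-free

connected-χ≤ : (G : Graph n) →
  ¬ (butterfly ⊴ G) → ¬ (hammer ⊴ G) → ¬ (join C₄ (K (suc m)) ⊴ G) →
  (∀ u v → Star (Adj G) u v) → ω G ≢ 2 → χ G ≤ ω G + triangle (suc m)
connected-χ≤ G b-free h-free c-free connected ω≢2 with a , clique ← ω-family G =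
  colourable⇒χ≤ {G = G} (connected-colourable G a clique (1+n≰n ∘ family⇒≤ω G) b-free h-free c-free connected ω≢2)

-- Components

-- A walk of `G` that starts in the component never leaves it, so it lifts to the induced subgraph;
-- any two vertices are then joined through the root.
component-connected : (G : Graph n) (C : Subset n) → IsComponent G C → ∀ i j → Star (Adj (G [ C ])) i j
component-connected G C (r , C⇔) i j = Star.reverse (adj-sym G) (from-root i) ◅◅ from-root j
  where
  open Equivalence
  lift : ∀ i {v} → Star (Adj G) (element C i) v → ∃[ j ] element C j ≡ v × Star (Adj (G [ C ])) i j
  lift i ε = i , refl , ε
  lift i (e ◅ es)
    with l , refl ← element⁻ C (from (C⇔ _) (to (C⇔ _) (element-∈ C i) ◅◅ e ◅ ε))
    with j , eq , path ← lift l es = j , eq , e ◅ path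
  root = element⁻ C (from (C⇔ r) ε)
  from-root : ∀ i → Star (Adj (G [ C ])) (proj₁ root) i
  from-root i with j , eq , path ← lift (proj₁ root)
      (subst (λ v → Star (Adj G) v (element C i)) (sym (proj₂ root)) (to (C⇔ _) (element-∈ C i)))
    with refl ← element-injective C eq = path

-- Each component receives the colouring computed by chromaticNumber, which depends only on the vertex
-- set of the component and hence agrees at adjacent vertices.
components-χ≤ : (G : Graph n) → Decidable (Star (Adj G)) →
                (∀ C → IsComponent G C → χ (G [ C ]) ≤ k) → χ G ≤ k
components-χ≤ {n} {k} G reach? bound =
  colourable⇒χ≤ {G = G} ((λ v → colour (component v) (comp v) (v∈ v)) ,
    λ u v uv → proper (component-≡ uv) (comp u) (comp v) (v∈ u) (v∈ v) uv)
  where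
  component : Fin n → Subset n
  component r = filter (reach? r)

  comp : ∀ r → IsComponent G (component r)
  comp r = r , λ v → mk⇔ (∈-filter⁻ (reach? r)) (∈-filter⁺ (reach? r))

  v∈ : ∀ v → v ∈ component v
  v∈ v = ∈-filter⁺ (reach? v) ε

  component-≡ : ∀ {u v} → Adj G u v → component u ≡ component v
  component-≡ {u} {v} uv = ⊆-antisym
    (∈-filter⁺ (reach? v) ∘ (adj-sym G uv ◅_) ∘ ∈-filter⁻ (reach? u))
    (∈-filter⁺ (reach? u) ∘ (uv ◅_) ∘ ∈-filter⁻ (reach? v))

  colour : ∀ C → IsComponent G C → ∀ {v} → v ∈ C → Fin k
  colour C C-comp v∈C =
    inject≤ (proj₁ (proj₁ (proj₂ (chromaticNumber (G [ C ])))) (proj₁ (element⁻ C v∈C))) (bound C C-comp)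

  -- The two component proofs may name different roots; they affect a colour only through the
  -- inequality given to `inject≤`.
  proper : ∀ {C D u v} → C ≡ D → ∀ C-comp D-comp (u∈ : u ∈ C) (v∈ : v ∈ D) →
           Adj G u v → colour C C-comp u∈ ≢ colour D D-comp v∈
  proper {C} refl _ _ u∈ v∈ uv eq =
    proj₂ (proj₁ (proj₂ (chromaticNumber (G [ C ])))) _ _
      (subst₂ (Adj G) (sym (proj₂ (element⁻ C u∈))) (sym (proj₂ (element⁻ C v∈))) uv)
      (inject≤-injective _ _ _ _ eq)

-- From components to the whole graph

-- Excluded middle is irrefutable for finitely many pairs at once. This serves in place of a
-- decision procedure for reachability, since the final inequality is decidable and hence stable.
¬¬-decidable : (R : Rel (Fin n) 0ℓ) → ¬ ¬ Decidable R
¬¬-decidable R = sequence applicative λ u → sequence applicative λ v → ¬¬-excluded-middle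
  where applicative = RawMonad.rawApplicative ¬¬-Monad

theorem3p5 : ∀ (p : ℕ) .{{_ : NonZero p}} {n : ℕ} (G : Graph n) →
    (((5 , butterfly) ∷ (5 , hammer) ∷ (4 + p , join C₄ (K p)) ∷ []) -free) G →
    (∀ (C : Subset n) → IsComponent G C → ω (G [ C ]) ≢ 2) →
    χ G ≤ ω G + (p * (p + 1)) / 2
theorem3p5 p@(suc q) G (b-free ∷ h-free ∷ c-free ∷ []) ω≢2 =
  subst (λ t → χ G ≤ ω G + t) (triangle-closed p)
    (decidable-stable (χ G ≤? ω G + triangle p)
      (¬¬-map (λ reach? → components-χ≤ G reach? component-χ≤) (¬¬-decidable (Star (Adj G)))))
  where
  component-χ≤ : ∀ C → IsComponent G C → χ (G [ C ]) ≤ ω G + triangle p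
  component-χ≤ C C-comp = ≤-trans
    (connected-χ≤ (G [ C ]) (b-free ∘ in-G butterfly) (h-free ∘ in-G hammer) (c-free ∘ in-G (join C₄ (K p)))
      (component-connected G C C-comp) (ω≢2 C C-comp))
    (+-monoˡ-≤ (triangle p) (ω-mono ([]-⊴ G C)))
    where
    in-G : ∀ {m} (H : Graph m) → H ⊴ (G [ C ]) → H ⊴ G
    in-G H H⊴ = ⊴-trans {F = H} {G = G [ C ]} {H = G} H⊴ ([]-⊴ G C)
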